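{- Let $T_{4,m}$ be the $(4,m)$-tadpole graph with $m\ge 1$ odd, i.e. the graph on vertices $1,\dots,4+m$ obtained by joining a cycle on the $4$ vertices $1,2,3,4$ (with edges $\{1,2\},\{2,3\},\{3,4\},\{4,1\}$) to a path on the $m$ vertices $5,6,\dots,4+m$ (with edges $\{i,i+1\}$ for $5\le i\le 3+m$) by the bridge $\{4,5\}$. Let $\mathcal{A}(T_{4,m})$ and $\mathcal{A}_{RW}(T_{4,m})$ be the evolution algebras associated to $T_{4,m}$ and to the symmetric random walk on $T_{4,m}$, respectively. Then the only homomorphism between $\mathcal{A}_{RW}(T_{4,m})$ and $\mathcal{A}(T_{4,m})$ is the null map. Thus $\mathcal{A}_{RW}(T_{4,m})\ncong\mathcal{A}(T_{4,m})$ as evolution algebras.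
   Context: Algebras are over a field $\mathbb{K}$. Let $G=(V,E)$ be a finite simple connected graph with adjacency matrix $A=(a_{ij})_{i,j\in V}$; let $\deg(i)=\sum_{k}a_{ik}$. The evolution algebra $\mathcal{A}(G)$ associated to $G$ is the algebra with basis $\{e_i\}_{i\in V}$ and bilinear product determined by $e_i\cdot e_i=\sum_{k\in V}a_{ik}e_k$ and $e_i\cdot e_j=0$ for $i\ne j$. The evolution algebra $\mathcal{A}_{RW}(G)$ associated to the symmetric random walk on $G$ is the algebra with basis $\{e_i\}_{i\in V}$ and bilinear product determined by $e_i\cdot e_i=\sum_{k\in V}\frac{a_{ik}}{\deg(i)}e_k$ and $e_i\cdot e_j=0$ for $i\neq j$. An algebra homomorphism is a $\mathbb{K}$-linear map $f$ with $f(xy)=f(x)f(y)$ for all $x,y$; an isomorphism (written $\cong$) is a bijective homomorphism. The null map is the map sending everything to $0$.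
   Formalization: The claim that only the null map is a homomorphism is proved for fields in which -1 is not a square; it fails if i²=-1 (e_1 ↦ e_1+i e_3, e_3 ↦ -(e_1+i e_3), other e_j ↦ 0). Non-isomorphism is proved without this. Vertex degrees are assumed nonzero in the field. -}

module Defs where

open import Level using (Level; _⊔_; 0ℓ) renaming (suc to lsuc)
open import Algebra.Apartness.Bundles using (HeytingField; HeytingCommutativeRing)
open import Algebra.Bundles using (CommutativeRing; Ring)
open import Algebra.Module.Bundles using (LeftModule)
import Algebra.Module.Morphism.Structures as ModuleMorphisms
import Algebra.Properties.CommutativeMonoid.Sum
import Algebra.Properties.Semiring.Mult
import Algebra.Properties.Semiring.Sum
open import Data.Bool.Base using (if_then_else_)
open import Data.Empty using (⊥-elim)
open import Data.Fin.Base using (Fin; zero; suc; toℕ; inject₁)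
open import Data.Fin.Properties using (toℕ<n; toℕ-inject₁) renaming (_≟_ to _≟ᶠ_)
open import Data.Nat.Base using (ℕ; zero; suc; pred; _+_; _*_; _≤_; _<_; z≤n; s≤s)
open import Data.Nat.Properties using (_≟_; _≤?_; +-0-commutativeMonoid)
open import Data.Product.Base using (_×_; _,_; proj₁; ∃-syntax)
open import Data.Sum.Base using (_⊎_; inj₁; inj₂; swap)
open import Function.Definitions using (Bijective)
open import Relation.Binary.Core using (Rel)
open import Relation.Binary.Construct.Closure.ReflexiveTransitive using (Star; ε; _◅_; _◅◅_; reverse)
open import Relation.Binary.Definitions using (Decidable; Symmetric; Irreflexive)
open import Relation.Binary.PropositionalEquality using (_≡_; _≢_; refl; cong)
open import Relation.Nullary using (¬_; does; yes; no)
open import Relation.Nullary.Decidable using (_×-dec_; _⊎-dec_)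

Odd : ℕ → Set
Odd m = ∃[ k ] m ≡ 1 + 2 * k

record ConnectedGraph (n : ℕ) : Set₁ where
  field
    Adj       : Rel (Fin n) 0ℓ
    adj?      : Decidable Adj
    symmetric : Symmetric Adj
    loopless  : Irreflexive _≡_ Adj
    connected : ∀ i j → Star Adj i j

  a : Fin n → Fin n → ℕ
  a i k = if does (adj? i k) then 1 else 0

  deg : Fin n → ℕ
  deg i = ∑[ k < n ] a i k
    where open Algebra.Properties.CommutativeMonoid.Sum +-0-commutativeMonoid

-- Vertices are labelled 1, …, 4+m, each edge being listed in one orientation.
TadpoleEdge : ℕ → Rel ℕ 0ℓ
TadpoleEdge m u v =
    (u ≡ 1 × v ≡ 2)
  ⊎ (u ≡ 2 × v ≡ 3)
  ⊎ (u ≡ 3 × v ≡ 4)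
  ⊎ (u ≡ 4 × v ≡ 1)
  ⊎ (u ≡ 4 × v ≡ 5)
  ⊎ (5 ≤ u × u ≤ 3 + m × v ≡ suc u)

tadpoleEdge? : ∀ m → Decidable (TadpoleEdge m)
tadpoleEdge? m u v =
        (u ≟ 1 ×-dec v ≟ 2)
  ⊎-dec (u ≟ 2 ×-dec v ≟ 3)
  ⊎-dec (u ≟ 3 ×-dec v ≟ 4)
  ⊎-dec (u ≟ 4 ×-dec v ≟ 1)
  ⊎-dec (u ≟ 4 ×-dec v ≟ 5)
  ⊎-dec (5 ≤? u ×-dec u ≤? 3 + m ×-dec v ≟ suc u)

tadpoleEdge-loopless : ∀ {m} u → ¬ TadpoleEdge m u u
tadpoleEdge-loopless u (inj₁ (refl , ()))
tadpoleEdge-loopless u (inj₂ (inj₁ (refl , ())))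
tadpoleEdge-loopless u (inj₂ (inj₂ (inj₁ (refl , ()))))
tadpoleEdge-loopless u (inj₂ (inj₂ (inj₂ (inj₁ (refl , ())))))
tadpoleEdge-loopless u (inj₂ (inj₂ (inj₂ (inj₂ (inj₁ (refl , ()))))))
tadpoleEdge-loopless u (inj₂ (inj₂ (inj₂ (inj₂ (inj₂ (_ , _ , ()))))))

tadpoleEdge-suc : ∀ {m} u → u < 3 + m → TadpoleEdge m (suc u) (suc (suc u))
tadpoleEdge-suc 0 _ = inj₁ (refl , refl)
tadpoleEdge-suc 1 _ = inj₂ (inj₁ (refl , refl))
tadpoleEdge-suc 2 _ = inj₂ (inj₂ (inj₁ (refl , refl)))
tadpoleEdge-suc 3 _ = inj₂ (inj₂ (inj₂ (inj₂ (inj₁ (refl , refl)))))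
tadpoleEdge-suc (suc (suc (suc (suc u)))) u<3+m =
  inj₂ (inj₂ (inj₂ (inj₂ (inj₂ (s≤s (s≤s (s≤s (s≤s (s≤s z≤n)))) , u<3+m , refl)))))

label : ∀ {n} → Fin n → ℕ
label i = suc (toℕ i)

TadpoleAdj : ∀ m → Rel (Fin (4 + m)) 0ℓ
TadpoleAdj m i j = TadpoleEdge m (label i) (label j) ⊎ TadpoleEdge m (label j) (label i)

tadpole-connected : ∀ m i j → Star (TadpoleAdj m) i j
tadpole-connected m i j = reverse swap (fromFirst i) ◅◅ fromFirst j
  where
  go : ∀ t (k : Fin (4 + m)) → toℕ k ≡ t → Star (TadpoleAdj m) zero k
  go zero    zero    _  = ε
  go (suc t) (suc k) eq = go t (inject₁ k) prev ◅◅ inj₁ edge ◅ ε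
    where
    prev : toℕ (inject₁ k) ≡ t
    prev rewrite toℕ-inject₁ k = cong pred eq

    edge : TadpoleEdge m (suc (toℕ (inject₁ k))) (suc (suc (toℕ k)))
    edge rewrite toℕ-inject₁ k = tadpoleEdge-suc (toℕ k) (toℕ<n k)

  fromFirst : ∀ k → Star (TadpoleAdj m) zero k
  fromFirst k = go (toℕ k) k refl

T₄ : ∀ m → ConnectedGraph (4 + m)
T₄ m = record
  { Adj       = TadpoleAdj m
  ; adj?      = λ i j → tadpoleEdge? m (label i) (label j) ⊎-dec tadpoleEdge? m (label j) (label i)
  ; symmetric = swap
  ; loopless  = λ { {i} refl (inj₁ e) → tadpoleEdge-loopless (label i) e
                  ; {i} refl (inj₂ e) → tadpoleEdge-loopless (label i) e }
  ; connected = tadpole-connected m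
  }

-- Not assumed associative, commutative or unital.
record Algebra {r ℓr} (R : Ring r ℓr) (a ℓa : Level) : Set (r ⊔ ℓr ⊔ lsuc (a ⊔ ℓa)) where
  infixl 7 _∙_
  field
    leftModule : LeftModule R a ℓa

  open LeftModule leftModule public

  field
    _∙_      : Carrierᴹ → Carrierᴹ → Carrierᴹ
    ∙-cong   : ∀ {x x′ y y′} → x ≈ᴹ x′ → y ≈ᴹ y′ → x ∙ y ≈ᴹ x′ ∙ y′
    distribˡ : ∀ x y z → x ∙ (y +ᴹ z) ≈ᴹ (x ∙ y) +ᴹ (x ∙ z)
    distribʳ : ∀ x y z → (y +ᴹ z) ∙ x ≈ᴹ (y ∙ x) +ᴹ (z ∙ x)
    scaleˡ   : ∀ c x y → (c *ₗ x) ∙ y ≈ᴹ c *ₗ (x ∙ y)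
    scaleʳ   : ∀ c x y → x ∙ (c *ₗ y) ≈ᴹ c *ₗ (x ∙ y)

module _ {r ℓr a ℓa b ℓb} {R : Ring r ℓr} (A : Algebra R a ℓa) (B : Algebra R b ℓb) where
  private
    module A = Algebra A
    module B = Algebra B

  open ModuleMorphisms.LeftModuleMorphisms A.rawLeftModule B.rawLeftModule

  record IsAlgebraHomomorphism (f : A.Carrierᴹ → B.Carrierᴹ) : Set (r ⊔ a ⊔ ℓa ⊔ ℓb) where
    field
      isLeftModuleHomomorphism : IsLeftModuleHomomorphism f
      ∙-homo                   : ∀ x y → f (x A.∙ y) B.≈ᴹ f x B.∙ f y

    open IsLeftModuleHomomorphism isLeftModuleHomomorphism public

  _≅_ : Set (r ⊔ a ⊔ ℓa ⊔ b ⊔ ℓb)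
  _≅_ = ∃[ f ] IsAlgebraHomomorphism f × Bijective A._≈ᴹ_ B._≈ᴹ_ f

  IsNull : (A.Carrierᴹ → B.Carrierᴹ) → Set (a ⊔ ℓb)
  IsNull f = ∀ x → f x B.≈ᴹ B.0ᴹ

module EvolutionAlgebras {c ℓ₁ ℓ₂} (𝕂 : HeytingField c ℓ₁ ℓ₂) where

  commutativeRing : CommutativeRing c ℓ₁
  commutativeRing = HeytingCommutativeRing.commutativeRing (HeytingField.heytingCommutativeRing 𝕂)

  open CommutativeRing commutativeRing
    renaming (_+_ to _+ᴷ_; _*_ to _*ᴷ_; _-_ to _-ᴷ_; refl to ≈-refl; sym to ≈-sym; trans to ≈-trans)
  open HeytingField 𝕂 using (_#_; #⇒invertible)
  open Algebra.Properties.Semiring.Sum semiring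
    using (sum; sum-syntax; sum-cong-≋; ∑-distrib-+; *-distribˡ-sum; sum-replicate-zero)
  open Algebra.Properties.Semiring.Mult semiring using () renaming (_×_ to _×ᴷ_)

  private
    variable
      n : ℕ

  fromℕ : ℕ → Carrier
  fromℕ k = k ×ᴷ 1#

  Kⁿ : ℕ → LeftModule ring c ℓ₁
  Kⁿ n = record
    { Carrierᴹ = Fin n → Carrier
    ; _≈ᴹ_ = λ x y → ∀ i → x i ≈ y i
    ; _+ᴹ_ = λ x y i → x i +ᴷ y i
    ; _*ₗ_ = λ s x i → s *ᴷ x i
    ; 0ᴹ   = λ _ → 0#
    ; -ᴹ_  = λ x i → - x i
    ; isLeftModule = record
      { isLeftSemimodule = record
        { +ᴹ-isCommutativeMonoid = record
          { isMonoid = record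
            { isSemigroup = record
              { isMagma = record
                { isEquivalence = record
                  { refl  = λ _ → ≈-refl
                  ; sym   = λ p i → ≈-sym (p i)
                  ; trans = λ p q i → ≈-trans (p i) (q i)
                  }
                ; ∙-cong = λ p q i → +-cong (p i) (q i)
                }
              ; assoc = λ x y z i → +-assoc (x i) (y i) (z i)
              }
            ; identity = (λ x i → +-identityˡ (x i)) , (λ x i → +-identityʳ (x i))
            }
          ; comm = λ x y i → +-comm (x i) (y i)
          }
        ; isPreleftSemimodule = record
          { *ₗ-cong      = λ p q i → *-cong p (q i)
          ; *ₗ-zeroˡ     = λ x i → zeroˡ (x i)
          ; *ₗ-distribʳ  = λ x s t i → distribʳ (x i) s t
          ; *ₗ-identityˡ = λ x i → *-identityˡ (x i)
          ; *ₗ-assoc     = λ s t x i → *-assoc s t (x i)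
          ; *ₗ-zeroʳ     = λ s i → zeroʳ s
          ; *ₗ-distribˡ  = λ s x y i → distribˡ s (x i) (y i)
          }
        }
      ; -ᴹ‿cong    = λ p i → -‿cong (p i)
      ; -ᴹ‿inverse = (λ x i → -‿inverseˡ (x i)) , (λ x i → -‿inverseʳ (x i))
      }
    }

  -- The evolution algebra with structure matrix w, in coordinates with respect to its
  -- natural basis e: bilinearity and  e i ∙ e i = ∑ₖ w i k · e k,  e i ∙ e j = 0 (i ≢ j)
  -- force  (x ∙ y)ₖ = ∑ᵢ xᵢ yᵢ w i k ; see e∙e-diagonal and e∙e-off-diagonal.
  evolutionAlgebra : (Fin n → Fin n → Carrier) → Algebra ring c ℓ₁
  evolutionAlgebra {n} w = record
    { leftModule = Kⁿ n
    ; _∙_      = λ x y k → ∑[ i < n ] (x i *ᴷ y i *ᴷ w i k)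
    ; ∙-cong   = λ p q k → sum-cong-≋ {n} (λ i → *-congʳ (*-cong (p i) (q i)))
    ; distribˡ = λ x y z k → ≈-trans
        (sum-cong-≋ {n} (λ i → ≈-trans (*-congʳ (distribˡ (x i) (y i) (z i))) (distribʳ (w i k) _ _)))
        (∑-distrib-+ {n} _ _)
    ; distribʳ = λ x y z k → ≈-trans
        (sum-cong-≋ {n} (λ i → ≈-trans (*-congʳ (distribʳ (x i) (y i) (z i))) (distribʳ (w i k) _ _)))
        (∑-distrib-+ {n} _ _)
    ; scaleˡ   = λ s x y k → ≈-trans
        (sum-cong-≋ {n} (λ i → ≈-trans (*-congʳ (*-assoc s (x i) (y i))) (*-assoc s _ (w i k))))
        (≈-sym (*-distribˡ-sum {n} s _))
    ; scaleʳ   = λ s x y k → ≈-trans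
        (sum-cong-≋ {n} (λ i → ≈-trans
          (*-congʳ (≈-trans (≈-sym (*-assoc (x i) s (y i)))
                   (≈-trans (*-congʳ (*-comm (x i) s)) (*-assoc s (x i) (y i)))))
          (*-assoc s _ (w i k))))
        (≈-sym (*-distribˡ-sum {n} s _))
    }

  e : Fin n → Fin n → Carrier
  e i k = if does (i ≟ᶠ k) then 1# else 0#

  module _ (w : Fin n → Fin n → Carrier) where
    open Algebra (evolutionAlgebra w) using (_∙_; _≈ᴹ_; 0ᴹ)

    e∙e-diagonal : ∀ i → e i ∙ e i ≈ᴹ w i
    e∙e-diagonal i k = ≈-trans (sum-cong-≋ {n} step) (sum-e i (λ j → w j k))
      where
      step : ∀ j → e i j *ᴷ e i j *ᴷ w j k ≈ e i j *ᴷ w j k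
      step j with i ≟ᶠ j
      ... | yes _ = *-congʳ (*-identityˡ 1#)
      ... | no  _ = *-congʳ (zeroˡ 0#)

      sum-zero : ∀ {n} (t : Fin n → Carrier) → (∀ j → t j ≈ 0#) → sum t ≈ 0#
      sum-zero {n} t t≈0 = ≈-trans (sum-cong-≋ {n} t≈0) (sum-replicate-zero n)

      sum-e : ∀ {n} (i : Fin n) v → ∑[ j < n ] (e i j *ᴷ v j) ≈ v i
      sum-e zero v = ≈-trans
        (+-cong (*-identityˡ _) (sum-zero (λ j → 0# *ᴷ v (suc j)) (λ j → zeroˡ _))) (+-identityʳ _)
      sum-e (suc i) v = ≈-trans (+-congʳ (zeroˡ _))
        (≈-trans (+-identityˡ _) (sum-e i (λ j → v (suc j))))

    e∙e-off-diagonal : ∀ {i j} → i ≢ j → e i ∙ e j ≈ᴹ 0ᴹ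
    e∙e-off-diagonal {i} {j} i≢j k = ≈-trans (sum-cong-≋ {n} step) (sum-replicate-zero n)
      where
      step : ∀ l → e i l *ᴷ e j l *ᴷ w l k ≈ 0#
      step l with i ≟ᶠ l | j ≟ᶠ l
      ... | yes refl | yes refl = ⊥-elim (i≢j refl)
      ... | yes _    | no  _    = ≈-trans (*-congʳ (zeroʳ _)) (zeroˡ _)
      ... | no  _    | _        = ≈-trans (*-congʳ (zeroˡ _)) (zeroˡ _)

  module _ (G : ConnectedGraph n) where
    open ConnectedGraph G

    𝒜 : Algebra ring c ℓ₁
    𝒜 = evolutionAlgebra (λ i k → fromℕ (a i k))

    -- Exactly what is needed for the quotients a i k / deg i to make sense in 𝕂.
    DegreesNonzero : Set ℓ₂
    DegreesNonzero = ∀ i → fromℕ (deg i) # 0#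

    -- The library's inverse is that of the difference  fromℕ (deg i) - 0# .
    𝒜RW : DegreesNonzero → Algebra ring c ℓ₁
    𝒜RW deg#0 = evolutionAlgebra (λ i k → fromℕ (a i k) *ᴷ proj₁ (#⇒invertible (deg#0 i)))

  -- If ι² = -1 then e₁ ↦ e₁ + ι e₃, e₃ ↦ -(e₁ + ι e₃), all other eᵢ ↦ 0 defines a non-null
  -- homomorphism 𝒜RW (T₄ m) → 𝒜 (T₄ m).
  NoSqrtOfMinusOne : Set (c ⊔ ℓ₁)
  NoSqrtOfMinusOne = ¬ (∃[ ι ] ι *ᴷ ι ≈ - 1#)

{-# OPTIONS --safe #-}

-- Write T i = f (e i), with vertices numbered from 0, so that 0 and 2 are the twins of the 4-cycle.
-- For m odd the kernel of the adjacency operator L is spanned by e 0 - e 2. Hence T i and T j have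
-- disjoint supports off the twins for i ≠ j, and f (e 0)² = f (e 2)² confines T 0 and T 2 to the
-- twins. With N = (T 0 0)² + (T 0 2)², comparing f with the squares of e 0, e 1 and e 3 then forces
-- N = 0, whence T 1 = T 3 = 0 and f is not injective. Without a square root of -1 also
-- T 0 = T 2 = 0, and f (e i ∙ e i) = 0 propagates the vanishing along the path.
-- Equality in a Heyting field is stable under double negation, so case distinctions on
-- whether a scalar is zero are available for all these conclusions.
module Submission where

open import Defs
open import Algebra.Apartness.Bundles using (HeytingField)
import Algebra.Apartness.Properties.HeytingCommutativeRing as HeytingProperties
open import Algebra.Bundles using (CommutativeRing; Ring)
import Algebra.Properties.CommutativeMonoid.Sum
import Algebra.Properties.Group
import Algebra.Properties.Monoid.Mult
import Algebra.Properties.Ring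
import Algebra.Properties.Semiring.Sum
import Algebra.Solver.Ring.NaturalCoefficients.Default
open import Data.Bool.Base using (Bool; _∧_; _∨_; if_then_else_)
open import Data.Bool.Properties using (∧-zeroʳ)
open import Data.Fin.Base using (Fin; zero; suc; toℕ)
open import Data.Fin.Patterns using (0F; 1F; 2F; 3F; 4F)
open import Data.Fin.Properties using (toℕ<n)
open import Data.Nat.Base using (ℕ; zero; suc; _+_; _*_; _≤_; _<_; _<ᵇ_; _≡ᵇ_; s≤s)
open import Data.Nat.Properties using (+-0-commutativeMonoid) renaming (*-comm to ℕ-*-comm)
open import Data.Product.Base using (_×_; _,_; proj₁; proj₂)
open import Function.Base using (_∘_)
open import Function.Bundles using (_⇔_; mk⇔)
open import Relation.Binary.PropositionalEquality as ≡ using (_≡_; _≢_)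
import Relation.Binary.Reasoning.Setoid
open import Relation.Nullary using (¬_; contradiction)
open import Relation.Nullary.Decidable using (does-⇔)

-- Entries of the tadpole's adjacency matrix.

private
  indicator : Bool → ℕ
  indicator b = if b then 1 else 0

consecutive-bounded : ∀ i {j l} → j < suc l → (i <ᵇ l) ∧ (j ≡ᵇ suc i) ≡ (j ≡ᵇ suc i)
consecutive-bounded i       {zero}          _         = ∧-zeroʳ _
consecutive-bounded zero    {suc j} {zero}  (s≤s ())
consecutive-bounded zero    {suc j} {suc l} _         = ≡.refl
consecutive-bounded (suc i) {suc j} {suc l} (s≤s j<l) = consecutive-bounded i j<l

-- The two alternatives exclude each other, so the indicator is additive. The first equation is
-- turned round because `toℕ k ≡ᵇ 3 + toℕ j` reduces to that form at a path vertex `k`.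
indicator-consecutive : ∀ i j → indicator ((j ≡ᵇ suc i) ∨ (i ≡ᵇ suc j))
                              ≡ indicator (suc i ≡ᵇ j) + indicator (i ≡ᵇ suc j)
indicator-consecutive zero    zero          = ≡.refl
indicator-consecutive zero    (suc zero)    = ≡.refl
indicator-consecutive zero    (suc (suc j)) = ≡.refl
indicator-consecutive (suc i) zero          = ≡.refl
indicator-consecutive (suc i) (suc j)       = indicator-consecutive i j

module Adjacency {n} (G : ConnectedGraph n) where
  open ConnectedGraph G

  a-symmetric : ∀ i k → a i k ≡ a k i
  a-symmetric i k = ≡.cong indicator (does-⇔ (mk⇔ symmetric symmetric) (adj? i k) (adj? k i))

module TadpoleEntries (l : ℕ) where
  open ConnectedGraph (T₄ (suc l)) using (a)
  open Adjacency (T₄ (suc l)) using (a-symmetric)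

  pathVertex : Fin (suc l) → Fin (4 + suc l)
  pathVertex j = suc (suc (suc (suc j)))

  a-path-0 : ∀ i → a (pathVertex i) 0F ≡ 0
  a-path-0 i rewrite ∧-zeroʳ (toℕ i <ᵇ l) = ≡.refl

  a-path-1 : ∀ i → a (pathVertex i) 1F ≡ 0
  a-path-1 i rewrite ∧-zeroʳ (toℕ i <ᵇ l) = ≡.refl

  a-path-2 : ∀ i → a (pathVertex i) 2F ≡ 0
  a-path-2 i rewrite ∧-zeroʳ (toℕ i <ᵇ l) = ≡.refl

  a-path-3 : ∀ i → a (pathVertex i) 3F ≡ indicator (toℕ i ≡ᵇ 0)
  a-path-3 zero    rewrite ∧-zeroʳ (0 <ᵇ l) = ≡.refl
  a-path-3 (suc i) rewrite ∧-zeroʳ (suc (toℕ i) <ᵇ l) = ≡.refl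

  -- Counted from 0, `pathVertex j` has number `4 + toℕ j`, so its neighbours have numbers one less
  -- and one more. At the end of the path the second number is out of range and its indicator is 0.
  a-path : ∀ k j → a k (pathVertex j)
                 ≡ indicator (toℕ k ≡ᵇ 3 + toℕ j) + indicator (toℕ k ≡ᵇ 5 + toℕ j)
  a-path 0F j = ≡.trans (a-symmetric 0F (pathVertex j)) (a-path-0 j)
  a-path 1F j = ≡.trans (a-symmetric 1F (pathVertex j)) (a-path-1 j)
  a-path 2F j = ≡.trans (a-symmetric 2F (pathVertex j)) (a-path-2 j)
  a-path 3F zero    = ≡.trans (a-symmetric 3F (pathVertex zero)) (a-path-3 zero)
  a-path 3F (suc j) = ≡.trans (a-symmetric 3F (pathVertex (suc j))) (a-path-3 (suc j))
  a-path (suc (suc (suc (suc i)))) j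
    rewrite consecutive-bounded (toℕ i) (toℕ<n j) | consecutive-bounded (toℕ j) (toℕ<n i)
    = indicator-consecutive (toℕ i) (toℕ j)

-- Arithmetic in a Heyting field.

module FieldProperties {c ℓ₁ ℓ₂} (𝕂 : HeytingField c ℓ₁ ℓ₂) where
  open HeytingField 𝕂 using (_#_; tight; #⇒invertible; heytingCommutativeRing) public
  open EvolutionAlgebras 𝕂 using (commutativeRing; fromℕ; NoSqrtOfMinusOne)
  open CommutativeRing commutativeRing public hiding (zero)
    renaming (_+_ to _+ᴷ_; _*_ to _*ᴷ_; _-_ to _-ᴷ_)
  open HeytingProperties heytingCommutativeRing using (1#0; x-0≈x; x#0y#0→xy#0) public
  open Algebra.Properties.Group +-group public
    using (inverseʳ-unique; x∙y⁻¹≈ε⇒x≈y; x≈y⇒x∙y⁻¹≈ε)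
    renaming (∙-cancelˡ to +-cancelˡ; ∙-cancelʳ to +-cancelʳ)
  open Algebra.Properties.Ring ring public using (x[y-z]≈xy-xz)
  open Algebra.Properties.Semiring.Sum semiring public
  open Algebra.Solver.Ring.NaturalCoefficients.Default commutativeSemiring public
    using (solve; _:=_; _:+_; _:*_; con; Polynomial)
  open Relation.Binary.Reasoning.Setoid setoid public

  ¬#⇒≈ : ∀ {x y} → ¬ x # y → x ≈ y
  ¬#⇒≈ = proj₁ (tight _ _)

  ≈⇒¬# : ∀ {x y} → x ≈ y → ¬ x # y
  ≈⇒¬# = proj₂ (tight _ _)

  -- By tightness `x ≈ y` is equivalent to the negation of `x # y`, and negations are stable.
  ≈-stable : ∀ {x y} → ¬ ¬ (x ≈ y) → x ≈ y
  ≈-stable ¬¬x≈y = ¬#⇒≈ (λ x#y → ¬¬x≈y (λ x≈y → ≈⇒¬# x≈y x#y))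

  -- Only the denial of `x ≈ 0#` is given, not `x # 0#`. If `y # 0#`, then `x # 0#` is impossible
  -- because it would make the product apart from 0, and tightness turns this into `x ≈ 0#`.
  x≉0∧xy≈0⇒y≈0 : ∀ {x y} → ¬ x ≈ 0# → x *ᴷ y ≈ 0# → y ≈ 0#
  x≉0∧xy≈0⇒y≈0 x≉0 xy≈0 =
    ¬#⇒≈ (λ y#0 → x≉0 (¬#⇒≈ (λ x#0 → ≈⇒¬# xy≈0 (x#0y#0→xy#0 x#0 y#0))))

  xx≈0⇒x≈0 : ∀ {x} → x *ᴷ x ≈ 0# → x ≈ 0#
  xx≈0⇒x≈0 xx≈0 = ≈-stable (λ x≉0 → x≉0 (x≉0∧xy≈0⇒y≈0 x≉0 xx≈0))

  -- Both `x` and `y` are roots of t² - (x + y)t + xy = t².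
  x+y≈0∧xy≈0⇒x≈0 : ∀ {x y} → x +ᴷ y ≈ 0# → x *ᴷ y ≈ 0# → x ≈ 0#
  x+y≈0∧xy≈0⇒x≈0 {x} {y} x+y≈0 xy≈0 = xx≈0⇒x≈0 (begin
    x *ᴷ x             ≈⟨ +-identityʳ _ ⟨
    x *ᴷ x +ᴷ 0#       ≈⟨ +-congˡ xy≈0 ⟨
    x *ᴷ x +ᴷ x *ᴷ y   ≈⟨ distribˡ x x y ⟨
    x *ᴷ (x +ᴷ y)      ≈⟨ *-congˡ x+y≈0 ⟩
    x *ᴷ 0#            ≈⟨ zeroʳ x ⟩
    0#                 ∎)

  x+y≈0∧xy≈0⇒y≈0 : ∀ {x y} → x +ᴷ y ≈ 0# → x *ᴷ y ≈ 0# → y ≈ 0#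
  x+y≈0∧xy≈0⇒y≈0 x+y≈0 xy≈0 =
    x+y≈0∧xy≈0⇒x≈0 (trans (+-comm _ _) x+y≈0) (trans (*-comm _ _) xy≈0)

  xx≈yy∧xy≈0⇒x≈0 : ∀ {x y} → x *ᴷ x ≈ y *ᴷ y → x *ᴷ y ≈ 0# → x ≈ 0#
  xx≈yy∧xy≈0⇒x≈0 {x} {y} xx≈yy xy≈0 = ≈-stable (λ x≉0 →
    x≉0 (xx≈0⇒x≈0 (x≉0∧xy≈0⇒y≈0 x≉0 (begin
      x *ᴷ (x *ᴷ x)   ≈⟨ *-congˡ xx≈yy ⟩
      x *ᴷ (y *ᴷ y)   ≈⟨ *-assoc x y y ⟨
      x *ᴷ y *ᴷ y     ≈⟨ *-congʳ xy≈0 ⟩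
      0# *ᴷ y         ≈⟨ zeroˡ y ⟩
      0#              ∎))))

  *-cancelˡ-≉0 : ∀ {x y z} → ¬ x ≈ 0# → x *ᴷ y ≈ x *ᴷ z → y ≈ z
  *-cancelˡ-≉0 {x} {y} {z} x≉0 xy≈xz = x∙y⁻¹≈ε⇒x≈y y z
    (x≉0∧xy≈0⇒y≈0 x≉0 (trans (x[y-z]≈xy-xz x y z) (x≈y⇒x∙y⁻¹≈ε xy≈xz)))

  -- If `x` were apart from 0, the quotient of `y` by `x` would be a square root of -1.
  NoSqrtOfMinusOne⇒anisotropic : NoSqrtOfMinusOne →
    ∀ {x y} → x *ᴷ x +ᴷ y *ᴷ y ≈ 0# → x ≈ 0#
  NoSqrtOfMinusOne⇒anisotropic noSqrt {x} {y} xx+yy≈0 = ¬#⇒≈ (λ x#0 →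
    let x⁻¹ , _ , [x-0]x⁻¹≈1 = #⇒invertible x#0
        xx⁻¹≈1 : x *ᴷ x⁻¹ ≈ 1#
        xx⁻¹≈1 = trans (*-congʳ (sym (x-0≈x x))) [x-0]x⁻¹≈1
    in noSqrt (y *ᴷ x⁻¹ , inverseʳ-unique 1# _ (begin
      1# +ᴷ y *ᴷ x⁻¹ *ᴷ (y *ᴷ x⁻¹)
        ≈⟨ +-congʳ (trans (*-cong xx⁻¹≈1 xx⁻¹≈1) (*-identityˡ 1#)) ⟨
      x *ᴷ x⁻¹ *ᴷ (x *ᴷ x⁻¹) +ᴷ y *ᴷ x⁻¹ *ᴷ (y *ᴷ x⁻¹)
        ≈⟨ solve 3 (λ x y i → x :* i :* (x :* i) :+ y :* i :* (y :* i) := (x :* x :+ y :* y) :* (i :* i))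
             refl x y x⁻¹ ⟩
      (x *ᴷ x +ᴷ y *ᴷ y) *ᴷ (x⁻¹ *ᴷ x⁻¹)
        ≈⟨ trans (*-congʳ xx+yy≈0) (zeroˡ _) ⟩
      0# ∎)))

  -- Consequences of 2 being nonzero.

  module CharacteristicNotTwo (2≉0 : ¬ 1# +ᴷ 1# ≈ 0#) where

    double-cancel : ∀ {x y} → x +ᴷ x ≈ y +ᴷ y → x ≈ y
    double-cancel {x} {y} 2x≈2y = *-cancelˡ-≉0 2≉0 (begin
      (1# +ᴷ 1#) *ᴷ x   ≈⟨ solve 1 (λ x → (con 1 :+ con 1) :* x := x :+ x) refl x ⟩
      x +ᴷ x            ≈⟨ 2x≈2y ⟩
      y +ᴷ y            ≈⟨ solve 1 (λ x → (con 1 :+ con 1) :* x := x :+ x) refl y ⟨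
      (1# +ᴷ 1#) *ᴷ y   ∎)

    double-zero : ∀ {x} → x +ᴷ x ≈ 0# → x ≈ 0#
    double-zero 2x≈0 = double-cancel (trans 2x≈0 (sym (+-identityˡ 0#)))

    -- If N := p² + q² were nonzero, then a ≠ 0 (otherwise p′ = -p, q′ = -q and orthogonality
    -- gives N = 0), hence b = 0, a = 2N = d and s = 0, so that 2a² = 3a².
    norm-vanishes : ∀ {p q p′ q′ s a b d} →
      p +ᴷ p′ ≈ a *ᴷ a +ᴷ a *ᴷ a →
      q +ᴷ q′ ≈ a *ᴷ a +ᴷ a *ᴷ a →
      p +ᴷ p′ +ᴷ s ≈ (1# +ᴷ 1# +ᴷ 1#) *ᴷ (b *ᴷ b +ᴷ d *ᴷ d) →
      p *ᴷ p′ +ᴷ q *ᴷ q′ ≈ 0# →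
      s *ᴷ p +ᴷ s *ᴷ q ≈ 0# →
      s *ᴷ p′ +ᴷ s *ᴷ q′ ≈ 0# →
      a *ᴷ b ≈ 0# →
      a +ᴷ b ≈ (p *ᴷ p +ᴷ q *ᴷ q) +ᴷ (p *ᴷ p +ᴷ q *ᴷ q) →
      d ≈ (p *ᴷ p +ᴷ q *ᴷ q) +ᴷ (p *ᴷ p +ᴷ q *ᴷ q) →
      p *ᴷ p +ᴷ q *ᴷ q ≈ 0#
    norm-vanishes {p} {q} {p′} {q′} {s} {a} {b} {d} p+p′ q+q′ p+p′+s orth orth-s orth-s′ ab≈0 a+b d≈2N =
      ≈-stable (λ N≉0 →
        let
          a≉0 : ¬ a ≈ 0#
          a≉0 a≈0 = N≉0 (begin
            p *ᴷ p +ᴷ q *ᴷ q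
              ≈⟨ +-identityʳ _ ⟨
            p *ᴷ p +ᴷ q *ᴷ q +ᴷ 0#
              ≈⟨ +-congˡ orth ⟨
            p *ᴷ p +ᴷ q *ᴷ q +ᴷ (p *ᴷ p′ +ᴷ q *ᴷ q′)
              ≈⟨ solve 4 (λ p q p′ q′ → p :* p :+ q :* q :+ (p :* p′ :+ q :* q′)
                                     := p :* (p :+ p′) :+ q :* (q :+ q′)) refl p q p′ q′ ⟩
            p *ᴷ (p +ᴷ p′) +ᴷ q *ᴷ (q +ᴷ q′)
              ≈⟨ +-cong (*-congˡ p+p′) (*-congˡ q+q′) ⟩
            p *ᴷ (a *ᴷ a +ᴷ a *ᴷ a) +ᴷ q *ᴷ (a *ᴷ a +ᴷ a *ᴷ a)
              ≈⟨ solve 3 (λ p q a → p :* (a :* a :+ a :* a) :+ q :* (a :* a :+ a :* a)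
                                  := a :* (a :* (p :+ p :+ q :+ q))) refl p q a ⟩
            a *ᴷ (a *ᴷ (p +ᴷ p +ᴷ q +ᴷ q))
              ≈⟨ trans (*-congʳ a≈0) (zeroˡ _) ⟩
            0# ∎)

          b≈0 : b ≈ 0#
          b≈0 = x≉0∧xy≈0⇒y≈0 a≉0 ab≈0

          a≈d : a ≈ d
          a≈d = begin
            a        ≈⟨ +-identityʳ a ⟨
            a +ᴷ 0#  ≈⟨ +-congˡ b≈0 ⟨
            a +ᴷ b   ≈⟨ a+b ⟩
            _        ≈⟨ d≈2N ⟨
            d        ∎

          4aas≈0 : (a *ᴷ (a *ᴷ s) +ᴷ a *ᴷ (a *ᴷ s)) +ᴷ (a *ᴷ (a *ᴷ s) +ᴷ a *ᴷ (a *ᴷ s)) ≈ 0#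
          4aas≈0 = begin
            (a *ᴷ (a *ᴷ s) +ᴷ a *ᴷ (a *ᴷ s)) +ᴷ (a *ᴷ (a *ᴷ s) +ᴷ a *ᴷ (a *ᴷ s))
              ≈⟨ solve 2 (λ a s → (a :* (a :* s) :+ a :* (a :* s)) :+ (a :* (a :* s) :+ a :* (a :* s))
                               := s :* (a :* a :+ a :* a) :+ s :* (a :* a :+ a :* a)) refl a s ⟩
            s *ᴷ (a *ᴷ a +ᴷ a *ᴷ a) +ᴷ s *ᴷ (a *ᴷ a +ᴷ a *ᴷ a)
              ≈⟨ +-cong (*-congˡ p+p′) (*-congˡ q+q′) ⟨
            s *ᴷ (p +ᴷ p′) +ᴷ s *ᴷ (q +ᴷ q′)
              ≈⟨ solve 5 (λ s p q p′ q′ → s :* (p :+ p′) :+ s :* (q :+ q′)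
                                       := (s :* p :+ s :* q) :+ (s :* p′ :+ s :* q′)) refl s p q p′ q′ ⟩
            (s *ᴷ p +ᴷ s *ᴷ q) +ᴷ (s *ᴷ p′ +ᴷ s *ᴷ q′)
              ≈⟨ +-cong orth-s orth-s′ ⟩
            0# +ᴷ 0#
              ≈⟨ +-identityˡ 0# ⟩
            0# ∎

          s≈0 : s ≈ 0#
          s≈0 = x≉0∧xy≈0⇒y≈0 a≉0 (x≉0∧xy≈0⇒y≈0 a≉0 (double-zero (double-zero 4aas≈0)))

          aa≈0 : a *ᴷ a ≈ 0#
          aa≈0 = sym (+-cancelˡ (a *ᴷ a +ᴷ a *ᴷ a) _ _ (begin
            a *ᴷ a +ᴷ a *ᴷ a +ᴷ 0#
              ≈⟨ +-cong p+p′ s≈0 ⟨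
            p +ᴷ p′ +ᴷ s
              ≈⟨ p+p′+s ⟩
            (1# +ᴷ 1# +ᴷ 1#) *ᴷ (b *ᴷ b +ᴷ d *ᴷ d)
              ≈⟨ *-congˡ (+-cong (*-cong b≈0 b≈0) (*-cong (sym a≈d) (sym a≈d))) ⟩
            (1# +ᴷ 1# +ᴷ 1#) *ᴷ (0# *ᴷ 0# +ᴷ a *ᴷ a)
              ≈⟨ solve 1 (λ a → (con 1 :+ con 1 :+ con 1) :* (con 0 :* con 0 :+ a :* a)
                              := a :* a :+ a :* a :+ a :* a) refl a ⟩
            a *ᴷ a +ᴷ a *ᴷ a +ᴷ a *ᴷ a ∎))
        in a≉0 (xx≈0⇒x≈0 aa≈0))

  -- Finite sums and neighbour recurrences along a path.

  fromℕ-+ : ∀ p q → fromℕ (p + q) ≈ fromℕ p +ᴷ fromℕ q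
  fromℕ-+ = Algebra.Properties.Monoid.Mult.×-homo-+ +-monoid 1#

  fromℕ-sum : ∀ {n} (t : Fin n → ℕ) →
    fromℕ (Algebra.Properties.CommutativeMonoid.Sum.sum +-0-commutativeMonoid t) ≈ sum (fromℕ ∘ t)
  fromℕ-sum {zero}  t = refl
  fromℕ-sum {suc n} t = trans (fromℕ-+ (t zero) _) (+-congˡ (fromℕ-sum (t ∘ suc)))

  sum-cong : ∀ {n} (s t : Fin n → Carrier) → (∀ j → s j ≈ t j) → sum s ≈ sum t
  sum-cong s t s≈t = sum-cong-≋ s≈t

  sum-zero : ∀ {n} (t : Fin n → Carrier) → (∀ j → t j ≈ 0#) → sum t ≈ 0#
  sum-zero {n} t t≈0 = trans (sum-cong-≋ t≈0) (sum-replicate-zero n)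

  -- Padding by 0 beyond the last index lets the end of the path obey the same two-neighbour formula
  -- as its inner vertices.
  extend : ∀ {n} → (Fin n → Carrier) → ℕ → Carrier
  extend {zero}  x _       = 0#
  extend {suc n} x zero    = x zero
  extend {suc n} x (suc p) = extend (x ∘ suc) p

  extend-zero : ∀ {n} {x : Fin n → Carrier} → (∀ i → x i ≈ 0#) → ∀ p → extend x p ≈ 0#
  extend-zero {zero}  x≈0 p       = refl
  extend-zero {suc n} x≈0 zero    = x≈0 zero
  extend-zero {suc n} x≈0 (suc p) = extend-zero (x≈0 ∘ suc) p

  sum-indicator : ∀ {n} (x : Fin n → Carrier) p →
    sum (λ k → x k *ᴷ fromℕ (indicator (toℕ k ≡ᵇ p))) ≈ extend x p
  sum-indicator {zero}  x p       = refl
  sum-indicator {suc n} x zero    = trans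
    (+-cong (trans (*-congˡ (+-identityʳ 1#)) (*-identityʳ _)) (sum-zero {n} _ (λ k → zeroʳ (x (suc k)))))
    (+-identityʳ _)
  sum-indicator {suc n} x (suc p) =
    trans (+-cong (zeroʳ _) (sum-indicator (x ∘ suc) p)) (+-identityˡ _)

  -- The rows link entries whose indices differ by 2. The entry at 1 fixes the odd indices upwards.
  -- Since `m` is odd, the last row reads the entry at `m` - 1 plus a padded 0, and this fixes the
  -- even indices downwards.
  odd-path-determined : ∀ k {m} → m ≡ suc (k * 2) → (y z : Fin (suc m) → Carrier) →
    extend y 1 ≈ extend z 1 →
    (∀ (j : Fin m) → extend y (toℕ j) +ᴷ extend y (2 + toℕ j)
                   ≈ extend z (toℕ j) +ᴷ extend z (2 + toℕ j)) →
    ∀ i → y i ≈ z i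
  odd-path-determined zero ≡.refl y z y₁≈z₁ rows 0F = +-cancelʳ 0# _ _ (rows 0F)
  odd-path-determined zero ≡.refl y z y₁≈z₁ rows 1F = y₁≈z₁
  odd-path-determined (suc k) ≡.refl y z y₁≈z₁ rows = go
    where
    y₃≈z₃ : y 3F ≈ z 3F
    y₃≈z₃ = +-cancelˡ (y 1F) _ _ (trans (rows 1F) (+-congʳ (sym y₁≈z₁)))

    rest : ∀ i → y (suc (suc i)) ≈ z (suc (suc i))
    rest = odd-path-determined k ≡.refl (λ i → y (suc (suc i))) (λ i → z (suc (suc i))) y₃≈z₃
             (λ j → rows (suc (suc j)))

    go : ∀ i → y i ≈ z i
    go 0F            = +-cancelʳ (y 2F) _ _ (trans (rows 0F) (+-congˡ (sym (rest 0F))))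
    go 1F            = y₁≈z₁
    go (suc (suc i)) = rest i

  -- Two consecutive zero vectors propagate through the recurrence. Each row is conditional on its
  -- middle vector being zero, which the induction has established by the time the row is used.
  path-vanishes : ∀ {p} m (Y : Fin (2 + m) → Fin p → Carrier) →
    (∀ r → Y 0F r ≈ 0#) → (∀ r → Y 1F r ≈ 0#) →
    (∀ (j : Fin (suc m)) → (∀ r → Y (suc j) r ≈ 0#) →
      ∀ r → extend (λ i → Y i r) (toℕ j) +ᴷ extend (λ i → Y i r) (2 + toℕ j) ≈ 0#) →
    ∀ i r → Y i r ≈ 0#
  path-vanishes m       Y Y₀≈0 Y₁≈0 rows zero          = Y₀≈0
  path-vanishes m       Y Y₀≈0 Y₁≈0 rows 1F            = Y₁≈0
  path-vanishes (suc m) Y Y₀≈0 Y₁≈0 rows (suc (suc i)) =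
    path-vanishes m (Y ∘ suc) Y₁≈0 Y₂≈0 (λ j → rows (suc j)) (suc i)
    where
    Y₂≈0 : ∀ r → Y 2F r ≈ 0#
    Y₂≈0 r = begin
      Y 2F r             ≈⟨ +-identityˡ _ ⟨
      0# +ᴷ Y 2F r       ≈⟨ +-congʳ (Y₀≈0 r) ⟨
      Y 0F r +ᴷ Y 2F r   ≈⟨ rows 0F Y₁≈0 r ⟩
      0#                 ∎

-- The adjacency operator and its kernel on the tadpole.

module _ {c ℓ₁ ℓ₂} (𝕂 : HeytingField c ℓ₁ ℓ₂) where
  open EvolutionAlgebras 𝕂
  open FieldProperties 𝕂

  module AdjacencyOperator {n} (G : ConnectedGraph n) where
    open ConnectedGraph G using (a; deg)
    open Adjacency G using (a-symmetric)

    -- The product of `𝒜 G` is `L` applied to the entrywise product of its factors.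
    L : (Fin n → Carrier) → Fin n → Carrier
    L x r = sum (λ k → x k *ᴷ fromℕ (a k r))

    L-zero : ∀ x → (∀ k → x k ≈ 0#) → ∀ r → L x r ≈ 0#
    L-zero x x≈0 r =
      sum-zero (λ k → x k *ᴷ fromℕ (a k r)) (λ k → trans (*-congʳ (x≈0 k)) (zeroˡ _))

    L-symmetric : ∀ x i → L x i ≈ sum (λ k → fromℕ (a i k) *ᴷ x k)
    L-symmetric x i = sum-cong (λ k → x k *ᴷ fromℕ (a k i)) _ (λ k → trans (*-comm _ _)
      (*-congʳ (reflexive (≡.cong fromℕ (a-symmetric k i)))))

    -- Writing the degree as a value of `L` lets the row formulas for `L` also compute degrees.
    fromℕ-deg : ∀ i → fromℕ (deg i) ≈ L (λ _ → 1#) i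
    fromℕ-deg i = trans (fromℕ-sum (a i)) (sym (trans (L-symmetric (λ _ → 1#) i)
      (sum-cong (λ k → fromℕ (a i k) *ᴷ 1#) _ (λ k → *-identityʳ _))))

  module TadpoleOperator (l : ℕ) where
    open ConnectedGraph (T₄ (suc l)) using (a)
    open TadpoleEntries l
    open AdjacencyOperator (T₄ (suc l))

    private
      +-congˡ⁴ : ∀ {p q r s t u} → t ≈ u → p +ᴷ (q +ᴷ (r +ᴷ (s +ᴷ t))) ≈ p +ᴷ (q +ᴷ (r +ᴷ (s +ᴷ u)))
      +-congˡ⁴ t≈u = +-congˡ (+-congˡ (+-congˡ (+-congˡ t≈u)))

      -- fromℕ 1 is 1# + 0#, whereas the solver reads con 1 as 1#.
      𝟏 : ∀ {n} → Polynomial n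
      𝟏 = con 1 :+ con 0

      path-sum-zero : ∀ (x : Fin (4 + suc l) → Carrier) r → (∀ i → a (pathVertex i) r ≡ 0) →
        sum (λ i → x (pathVertex i) *ᴷ fromℕ (a (pathVertex i) r)) ≈ 0#
      path-sum-zero x r a≡0 =
        sum-zero _ (λ i → trans (*-congˡ {x (pathVertex i)} (reflexive (≡.cong fromℕ (a≡0 i)))) (zeroʳ _))

    L-0 : ∀ x → L x 0F ≈ x 1F +ᴷ x 3F
    L-0 x = trans (+-congˡ⁴ (path-sum-zero x 0F a-path-0))
      (solve 4 (λ x₀ x₁ x₂ x₃ → x₀ :* con 0 :+ (x₁ :* 𝟏 :+ (x₂ :* con 0 :+ (x₃ :* 𝟏 :+ con 0)))
                              := x₁ :+ x₃) refl (x 0F) (x 1F) (x 2F) (x 3F))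

    L-1 : ∀ x → L x 1F ≈ x 0F +ᴷ x 2F
    L-1 x = trans (+-congˡ⁴ (path-sum-zero x 1F a-path-1))
      (solve 4 (λ x₀ x₁ x₂ x₃ → x₀ :* 𝟏 :+ (x₁ :* con 0 :+ (x₂ :* 𝟏 :+ (x₃ :* con 0 :+ con 0)))
                              := x₀ :+ x₂) refl (x 0F) (x 1F) (x 2F) (x 3F))

    L-2 : ∀ x → L x 2F ≈ x 1F +ᴷ x 3F
    L-2 x = trans (+-congˡ⁴ (path-sum-zero x 2F a-path-2))
      (solve 4 (λ x₀ x₁ x₂ x₃ → x₀ :* con 0 :+ (x₁ :* 𝟏 :+ (x₂ :* con 0 :+ (x₃ :* 𝟏 :+ con 0)))
                              := x₁ :+ x₃) refl (x 0F) (x 1F) (x 2F) (x 3F))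

    L-3 : ∀ x → L x 3F ≈ x 0F +ᴷ x 2F +ᴷ x 4F
    L-3 x = trans (+-congˡ⁴ (trans
        (sum-cong (λ i → x (pathVertex i) *ᴷ fromℕ (a (pathVertex i) 3F)) _
          (λ i → *-congˡ (reflexive (≡.cong fromℕ (a-path-3 i)))))
        (sum-indicator (x ∘ pathVertex) 0)))
      (solve 5 (λ x₀ x₁ x₂ x₃ x₄ → x₀ :* 𝟏 :+ (x₁ :* con 0 :+ (x₂ :* 𝟏 :+ (x₃ :* con 0 :+ x₄)))
                              := x₀ :+ x₂ :+ x₄) refl (x 0F) (x 1F) (x 2F) (x 3F) (x 4F))

    L-path : ∀ x j → L x (pathVertex j) ≈ extend x (3 + toℕ j) +ᴷ extend x (5 + toℕ j)
    L-path x j = begin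
      L x (pathVertex j)
        ≈⟨ sum-cong _ _ (λ k → trans
             (*-congˡ (trans (reflexive (≡.cong fromℕ (a-path k j))) (fromℕ-+ (before k) (after k))))
             (distribˡ (x k) _ _)) ⟩
      sum (λ k → x k *ᴷ fromℕ (before k) +ᴷ x k *ᴷ fromℕ (after k))
        ≈⟨ ∑-distrib-+ (λ k → x k *ᴷ fromℕ (before k)) (λ k → x k *ᴷ fromℕ (after k)) ⟩
      sum (λ k → x k *ᴷ fromℕ (before k)) +ᴷ sum (λ k → x k *ᴷ fromℕ (after k))
        ≈⟨ +-cong (sum-indicator x (3 + toℕ j)) (sum-indicator x (5 + toℕ j)) ⟩
      extend x (3 + toℕ j) +ᴷ extend x (5 + toℕ j) ∎
      where
      before after : Fin (4 + suc l) → ℕ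
      before k = indicator (toℕ k ≡ᵇ 3 + toℕ j)
      after  k = indicator (toℕ k ≡ᵇ 5 + toℕ j)

    -- The kernel of L is spanned by the difference of the twin vertices 0 and 2.
    module _ (odd : Odd (suc l)) (u v : Fin (4 + suc l) → Carrier) (Lu≈Lv : ∀ r → L u r ≈ L v r) where

      private
        -- Row 3 is the twin sum plus the entry at 4, and row 1 already fixes the twin sum.
        fourth≈ : u 4F ≈ v 4F
        fourth≈ = +-cancelˡ (u 0F +ᴷ u 2F) _ _ (begin
          u 0F +ᴷ u 2F +ᴷ u 4F   ≈⟨ L-3 u ⟨
          L u 3F                 ≈⟨ Lu≈Lv 3F ⟩
          L v 3F                 ≈⟨ L-3 v ⟩
          v 0F +ᴷ v 2F +ᴷ v 4F   ≈⟨ +-congʳ (trans (sym (L-1 v)) (trans (sym (Lu≈Lv 1F)) (L-1 u))) ⟩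
          u 0F +ᴷ u 2F +ᴷ v 4F   ∎)

        path≈ : ∀ i → u (suc (suc (suc i))) ≈ v (suc (suc (suc i)))
        -- The vector starts at vertex 3, so it has one entry more than the path, and its entry 1 is
        -- the one at vertex 4.
        path≈ = odd-path-determined (proj₁ odd)
          (≡.trans (proj₂ odd) (≡.cong suc (ℕ-*-comm 2 (proj₁ odd)))) _ _ fourth≈
          (λ j → trans (sym (L-path u j)) (trans (Lu≈Lv (pathVertex j)) (L-path v j)))

      L-determines-twin-sum : u 0F +ᴷ u 2F ≈ v 0F +ᴷ v 2F
      L-determines-twin-sum = trans (sym (L-1 u)) (trans (Lu≈Lv 1F) (L-1 v))

      L-determines : ∀ k → k ≢ 0F → k ≢ 2F → u k ≈ v k
      L-determines 0F k≢0 k≢2 = contradiction ≡.refl k≢0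
      L-determines 1F k≢0 k≢2 = +-cancelʳ (u 3F) _ _ (begin
        u 1F +ᴷ u 3F   ≈⟨ L-0 u ⟨
        L u 0F         ≈⟨ Lu≈Lv 0F ⟩
        L v 0F         ≈⟨ L-0 v ⟩
        v 1F +ᴷ v 3F   ≈⟨ +-congˡ (path≈ 0F) ⟨
        v 1F +ᴷ u 3F   ∎)
      L-determines 2F k≢0 k≢2 = contradiction ≡.refl k≢2
      L-determines (suc (suc (suc i))) k≢0 k≢2 = path≈ i

  -- Homomorphisms on the natural basis.

  module EvolutionHomomorphism
    {n} {w w′ : Fin n → Fin n → Carrier} {f : (Fin n → Carrier) → (Fin n → Carrier)}
    (hom : IsAlgebraHomomorphism (evolutionAlgebra w) (evolutionAlgebra w′) f) where

    private
      module f = IsAlgebraHomomorphism hom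

    f-combination : ∀ {p} (x : Fin p → Carrier) (v : Fin p → Fin n → Carrier) r →
      f (λ s → sum (λ k → x k *ᴷ v k s)) r ≈ sum (λ k → x k *ᴷ f (v k) r)
    f-combination {zero}  x v r = f.0ᴹ-homo r
    f-combination {suc p} x v r = begin
      f (λ s → x zero *ᴷ v zero s +ᴷ sum (λ k → x (suc k) *ᴷ v (suc k) s)) r
        ≈⟨ f.+ᴹ-homo (λ s → x zero *ᴷ v zero s) (λ s → sum (λ k → x (suc k) *ᴷ v (suc k) s)) r ⟩
      f (λ s → x zero *ᴷ v zero s) r +ᴷ f (λ s → sum (λ k → x (suc k) *ᴷ v (suc k) s)) r
        ≈⟨ +-cong (f.*ₗ-homo (x zero) (v zero) r) (f-combination (x ∘ suc) (v ∘ suc) r) ⟩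
      x zero *ᴷ f (v zero) r +ᴷ sum (λ k → x (suc k) *ᴷ f (v (suc k)) r) ∎

    sum-e : ∀ {p} (x : Fin p → Carrier) s → x s ≈ sum (λ k → x k *ᴷ e k s)
    sum-e {suc p} x zero    = sym (trans
      (+-cong (*-identityʳ _) (sum-zero {p} (λ k → x (suc k) *ᴷ 0#) (λ k → zeroʳ _))) (+-identityʳ _))
    sum-e {suc p} x (suc s) = sym (trans
      (+-cong (zeroʳ _) (sym (sum-e (x ∘ suc) s))) (+-identityˡ _))

    f-expand : ∀ x r → f x r ≈ sum (λ k → x k *ᴷ f (e k) r)
    f-expand x r = trans (f.⟦⟧-cong (sum-e x) r) (f-combination x e r)

    images-orthogonal : ∀ {i j} → i ≢ j → ∀ r →
      sum (λ k → f (e i) k *ᴷ f (e j) k *ᴷ w′ k r) ≈ 0#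
    images-orthogonal {i} {j} i≢j r =
      trans (sym (f.∙-homo (e i) (e j) r))
        (trans (f.⟦⟧-cong (e∙e-off-diagonal w i≢j) r) (f.0ᴹ-homo r))

    -- Both sides compute `f (e i ∙ e i)`, the left by linearity and the right by multiplicativity.
    image-square : ∀ i r →
      sum (λ k → w i k *ᴷ f (e k) r) ≈ sum (λ k → f (e i) k *ᴷ f (e i) k *ᴷ w′ k r)
    image-square i r =
      trans (sym (f-expand (w i) r))
        (trans (f.⟦⟧-cong (λ s → sym (e∙e-diagonal w i s)) r) (f.∙-homo (e i) (e i) r))

  module GraphHomomorphism
    {n} (G : ConnectedGraph n) (deg#0 : DegreesNonzero G)
    {f : (Fin n → Carrier) → (Fin n → Carrier)}
    (hom : IsAlgebraHomomorphism (𝒜RW G deg#0) (𝒜 G) f) where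

    open ConnectedGraph G using (a; deg)
    open AdjacencyOperator G
    open EvolutionHomomorphism
      {w = λ i k → fromℕ (a i k) *ᴷ proj₁ (#⇒invertible (deg#0 i))}
      {w′ = λ i k → fromℕ (a i k)} hom public

    T : Fin n → Fin n → Carrier
    T i = f (e i)

    infixl 7 _⊙_
    _⊙_ : (x y : Fin n → Carrier) → Fin n → Carrier
    (x ⊙ y) k = x k *ᴷ y k

    -- The zero is written as a value of `L` so that the description of the kernel of `L` applies
    -- directly.
    L-orthogonal : ∀ {i j} → i ≢ j → ∀ r → L (T i ⊙ T j) r ≈ L (λ _ → 0#) r
    L-orthogonal i≢j r = trans (images-orthogonal i≢j r) (sym (L-zero (λ _ → 0#) (λ _ → refl) r))

    -- This is `image-square` with the denominator cleared. On the left `L` acts on the index of the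
    -- basis vector, on the right on the coordinates of its image.
    L-square : ∀ i r → L (λ k → T k r) i ≈ L (λ _ → 1#) i *ᴷ L (T i ⊙ T i) r
    L-square i r = begin
      L (λ k → T k r) i
        ≈⟨ L-symmetric (λ k → T k r) i ⟩
      sum (λ k → A k *ᴷ T k r)
        ≈⟨ sum-cong (λ k → A k *ᴷ T k r) _ (λ k → cancel (A k) (T k r)) ⟩
      sum (λ k → fromℕ (deg i) *ᴷ (A k *ᴷ deg⁻¹ *ᴷ T k r))
        ≈⟨ *-distribˡ-sum (fromℕ (deg i)) (λ k → A k *ᴷ deg⁻¹ *ᴷ T k r) ⟨
      fromℕ (deg i) *ᴷ sum (λ k → A k *ᴷ deg⁻¹ *ᴷ T k r)
        ≈⟨ *-cong (fromℕ-deg i) (image-square i r) ⟩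
      L (λ _ → 1#) i *ᴷ L (T i ⊙ T i) r ∎
      where
      A : Fin n → Carrier
      A k = fromℕ (a i k)

      invertible = #⇒invertible (deg#0 i)

      deg⁻¹ : Carrier
      deg⁻¹ = proj₁ invertible

      deg*deg⁻¹≈1 : fromℕ (deg i) *ᴷ deg⁻¹ ≈ 1#
      deg*deg⁻¹≈1 = trans (*-congʳ (sym (x-0≈x _))) (proj₂ (proj₂ invertible))

      cancel : ∀ x y → x *ᴷ y ≈ fromℕ (deg i) *ᴷ (x *ᴷ deg⁻¹ *ᴷ y)
      cancel x y = begin
        x *ᴷ y                               ≈⟨ *-identityˡ _ ⟨
        1# *ᴷ (x *ᴷ y)                       ≈⟨ *-congʳ deg*deg⁻¹≈1 ⟨
        fromℕ (deg i) *ᴷ deg⁻¹ *ᴷ (x *ᴷ y)   ≈⟨ solve 4 (λ d d′ x y → d :* d′ :* (x :* y) := d :* (x :* d′ :* y))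
                                                  refl (fromℕ (deg i)) deg⁻¹ x y ⟩
        fromℕ (deg i) *ᴷ (x *ᴷ deg⁻¹ *ᴷ y)   ∎

  -- Homomorphisms between the two tadpole algebras.

  module TadpoleHomomorphism
    (l : ℕ) (odd : Odd (suc l)) (deg#0 : DegreesNonzero (T₄ (suc l)))
    {f : (Fin (4 + suc l) → Carrier) → (Fin (4 + suc l) → Carrier)}
    (hom : IsAlgebraHomomorphism (𝒜RW (T₄ (suc l)) deg#0) (𝒜 (T₄ (suc l))) f) where

    open TadpoleEntries l using (pathVertex)
    open AdjacencyOperator (T₄ (suc l))
    open TadpoleOperator l
    open GraphHomomorphism (T₄ (suc l)) deg#0 hom

    -- Vertex 0 has degree 2, which is invertible by assumption.
    2≉0 : ¬ 1# +ᴷ 1# ≈ 0#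
    2≉0 2≈0 = ≈⇒¬# (trans (fromℕ-deg 0F) (trans (L-0 (λ _ → 1#)) 2≈0)) (deg#0 0F)

    open CharacteristicNotTwo 2≉0

    private
      2* : ∀ x → (1# +ᴷ 1#) *ᴷ x ≈ x +ᴷ x
      2* = solve 1 (λ x → (con 1 :+ con 1) :* x := x :+ x) refl

    square-0 : ∀ r → T 1F r +ᴷ T 3F r ≈ L (T 0F ⊙ T 0F) r +ᴷ L (T 0F ⊙ T 0F) r
    square-0 r = trans (sym (L-0 (λ k → T k r))) (trans (L-square 0F r)
      (trans (*-congʳ (L-0 (λ _ → 1#))) (2* _)))

    square-1 : ∀ r → T 0F r +ᴷ T 2F r ≈ L (T 1F ⊙ T 1F) r +ᴷ L (T 1F ⊙ T 1F) r
    square-1 r = trans (sym (L-1 (λ k → T k r))) (trans (L-square 1F r)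
      (trans (*-congʳ (L-1 (λ _ → 1#))) (2* _)))

    square-2 : ∀ r → T 1F r +ᴷ T 3F r ≈ L (T 2F ⊙ T 2F) r +ᴷ L (T 2F ⊙ T 2F) r
    square-2 r = trans (sym (L-2 (λ k → T k r))) (trans (L-square 2F r)
      (trans (*-congʳ (L-2 (λ _ → 1#))) (2* _)))

    square-3 : ∀ r → T 0F r +ᴷ T 2F r +ᴷ T 4F r ≈ (1# +ᴷ 1# +ᴷ 1#) *ᴷ L (T 3F ⊙ T 3F) r
    square-3 r = trans (sym (L-3 (λ k → T k r))) (trans (L-square 3F r) (*-congʳ (L-3 (λ _ → 1#))))

    -- Rows 0 and 2 of `L` coincide, so by `L-square` the two columns have the same image under `L`
    -- and can differ only at the twins.
    twin-columns : ∀ k → k ≢ 0F → k ≢ 2F → T k 0F ≈ T k 2F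
    twin-columns = L-determines odd (λ k → T k 0F) (λ k → T k 2F) (λ i →
      trans (L-square i 0F) (trans (*-congˡ (trans (L-0 (T i ⊙ T i)) (sym (L-2 (T i ⊙ T i))))) (sym (L-square i 2F))))

    orthogonal : ∀ i j → i ≢ j → ∀ k → k ≢ 0F → k ≢ 2F → T i k *ᴷ T j k ≈ 0#
    orthogonal i j i≢j = L-determines odd (T i ⊙ T j) (λ _ → 0#) (L-orthogonal i≢j)

    twin-orthogonal : ∀ i j → i ≢ j → T i 0F *ᴷ T j 0F +ᴷ T i 2F *ᴷ T j 2F ≈ 0#
    twin-orthogonal i j i≢j = trans
      (L-determines-twin-sum odd (T i ⊙ T j) (λ _ → 0#) (L-orthogonal i≢j))
      (+-identityˡ 0#)

    L-square-0≈L-square-2 : ∀ r → L (T 0F ⊙ T 0F) r ≈ L (T 2F ⊙ T 2F) r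
    L-square-0≈L-square-2 r = double-cancel (trans (sym (square-0 r)) (square-2 r))

    -- Off the twins the entries of `T 0F` and `T 2F` have equal squares and zero product.
    T0≈0 : ∀ k → k ≢ 0F → k ≢ 2F → T 0F k ≈ 0#
    T0≈0 k k≢0 k≢2 = xx≈yy∧xy≈0⇒x≈0
      (L-determines odd (T 0F ⊙ T 0F) (T 2F ⊙ T 2F) L-square-0≈L-square-2 k k≢0 k≢2)
      (orthogonal 0F 2F (λ ()) k k≢0 k≢2)

    T2≈0 : ∀ k → k ≢ 0F → k ≢ 2F → T 2F k ≈ 0#
    T2≈0 k k≢0 k≢2 = xx≈yy∧xy≈0⇒x≈0
      (L-determines odd (T 2F ⊙ T 2F) (T 0F ⊙ T 0F) (λ r → sym (L-square-0≈L-square-2 r)) k k≢0 k≢2)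
      (orthogonal 2F 0F (λ ()) k k≢0 k≢2)

    -- `T 0F` is supported on the twins, and their only neighbours are 1 and 3.
    L-T0² : ∀ r → r ≢ 1F → r ≢ 3F → L (T 0F ⊙ T 0F) r ≈ 0#
    L-T0² = go
      where
      T0²≈0 : ∀ k → k ≢ 0F → k ≢ 2F → T 0F k *ᴷ T 0F k ≈ 0#
      T0²≈0 k k≢0 k≢2 = trans (*-congʳ (T0≈0 k k≢0 k≢2)) (zeroˡ _)

      0+0 : ∀ {x y} → x ≈ 0# → y ≈ 0# → x +ᴷ y ≈ 0#
      0+0 x≈0 y≈0 = trans (+-cong x≈0 y≈0) (+-identityˡ 0#)

      tail≈0 : ∀ p → extend (T 0F ⊙ T 0F) (3 + p) ≈ 0#
      tail≈0 = extend-zero (λ i → T0²≈0 (suc (suc (suc i))) (λ ()) (λ ()))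

      go : ∀ r → r ≢ 1F → r ≢ 3F → L (T 0F ⊙ T 0F) r ≈ 0#
      go 0F _ _ = trans (L-0 (T 0F ⊙ T 0F)) (0+0 (T0²≈0 1F (λ ()) (λ ())) (T0²≈0 3F (λ ()) (λ ())))
      go 1F r≢1 _ = contradiction ≡.refl r≢1
      go 2F _ _ = trans (L-2 (T 0F ⊙ T 0F)) (0+0 (T0²≈0 1F (λ ()) (λ ())) (T0²≈0 3F (λ ()) (λ ())))
      go 3F _ r≢3 = contradiction ≡.refl r≢3
      go (suc (suc (suc (suc j)))) _ _ =
        trans (L-path (T 0F ⊙ T 0F) j) (0+0 (tail≈0 (toℕ j)) (tail≈0 (2 + toℕ j)))

    T1+T3≈0 : ∀ r → r ≢ 1F → r ≢ 3F → T 1F r +ᴷ T 3F r ≈ 0#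
    T1+T3≈0 r r≢1 r≢3 = trans (square-0 r)
      (trans (+-cong (L-T0² r r≢1 r≢3) (L-T0² r r≢1 r≢3)) (+-identityˡ 0#))

    -- Off the twins this is orthogonality. At the twins the columns agree, so the two terms of
    -- `twin-orthogonal` are equal and 2 can be cancelled.
    T1*T3≈0 : ∀ r → T 1F r *ᴷ T 3F r ≈ 0#
    T1*T3≈0 0F = double-zero (trans
      (+-congˡ (*-cong (twin-columns 1F (λ ()) (λ ())) (twin-columns 3F (λ ()) (λ ()))))
      (twin-orthogonal 1F 3F (λ ())))
    T1*T3≈0 1F = orthogonal 1F 3F (λ ()) 1F (λ ()) (λ ())
    T1*T3≈0 2F = double-zero (trans
      (+-congʳ (*-cong (sym (twin-columns 1F (λ ()) (λ ()))) (sym (twin-columns 3F (λ ()) (λ ())))))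
      (twin-orthogonal 1F 3F (λ ())))
    T1*T3≈0 (suc (suc (suc r))) = orthogonal 1F 3F (λ ()) (suc (suc (suc r))) (λ ()) (λ ())

    N : Carrier
    N = T 0F 0F *ᴷ T 0F 0F +ᴷ T 0F 2F *ᴷ T 0F 2F

    T1+T3-at-1 : T 1F 1F +ᴷ T 3F 1F ≈ N +ᴷ N
    T1+T3-at-1 = trans (square-0 1F) (+-cong (L-1 (T 0F ⊙ T 0F)) (L-1 (T 0F ⊙ T 0F)))

    T1+T3-at-3 : T 1F 3F +ᴷ T 3F 3F ≈ N +ᴷ N
    T1+T3-at-3 = trans (square-0 3F) (+-cong L-T0²-3 L-T0²-3)
      where
      L-T0²-3 : L (T 0F ⊙ T 0F) 3F ≈ N
      L-T0²-3 = trans (L-3 (T 0F ⊙ T 0F)) (trans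
        (+-congˡ (trans (*-congʳ (T0≈0 4F (λ ()) (λ ()))) (zeroˡ _))) (+-identityʳ _))

    T1≈0 : ∀ r → r ≢ 1F → r ≢ 3F → T 1F r ≈ 0#
    T1≈0 r r≢1 r≢3 = x+y≈0∧xy≈0⇒x≈0 (T1+T3≈0 r r≢1 r≢3) (T1*T3≈0 r)

    -- At coordinate 4 the images of the twins vanish, so `square-1` makes the squares of `T 1F` at
    -- 3 and 5 sum to 0. The entry at 5 is 0, by `T1≈0` or, on a path with a single vertex, by
    -- padding.
    T13≈0 : T 1F 3F ≈ 0#
    T13≈0 = xx≈0⇒x≈0 (begin
      T 1F 3F *ᴷ T 1F 3F
        ≈⟨ +-identityʳ _ ⟨
      T 1F 3F *ᴷ T 1F 3F +ᴷ 0#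
        ≈⟨ +-congˡ (extend-zero {x = λ i → (T 1F ⊙ T 1F) (pathVertex (suc i))} (λ i →
             trans (*-congʳ (T1≈0 (pathVertex (suc i)) (λ ()) (λ ()))) (zeroˡ _)) 0) ⟨
      T 1F 3F *ᴷ T 1F 3F +ᴷ extend (T 1F ⊙ T 1F) 5
        ≈⟨ L-path (T 1F ⊙ T 1F) 0F ⟨
      L (T 1F ⊙ T 1F) 4F
        ≈⟨ double-zero (trans (sym (square-1 4F)) (trans
             (+-cong (T0≈0 4F (λ ()) (λ ())) (T2≈0 4F (λ ()) (λ ()))) (+-identityˡ 0#))) ⟩
      0# ∎)

    N≈0 : N ≈ 0#
    -- Here `p`, `q` are the twin entries of `T 0F`, and `p′`, `q′` those of `T 2F`. Further `s` is
    -- `T 4F 0F`, `a` is `T 1F 1F`, `b` is `T 3F 1F` and `d` is `T 3F 3F`.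
    N≈0 = norm-vanishes
      (trans (square-1 0F) (+-cong (L-T1² (L-0 (T 1F ⊙ T 1F))) (L-T1² (L-0 (T 1F ⊙ T 1F)))))
      (trans (square-1 2F) (+-cong (L-T1² (L-2 (T 1F ⊙ T 1F))) (L-T1² (L-2 (T 1F ⊙ T 1F)))))
      (trans (square-3 0F) (*-congˡ (L-0 (T 3F ⊙ T 3F))))
      (twin-orthogonal 0F 2F (λ ()))
      (orthogonal-4 0F (λ ()))
      (orthogonal-4 2F (λ ()))
      (orthogonal 1F 3F (λ ()) 1F (λ ()) (λ ()))
      T1+T3-at-1
      (trans (sym (+-identityˡ _)) (trans (+-congʳ (sym T13≈0)) T1+T3-at-3))
      where
      L-T1² : ∀ {y} → y ≈ T 1F 1F *ᴷ T 1F 1F +ᴷ T 1F 3F *ᴷ T 1F 3F → y ≈ T 1F 1F *ᴷ T 1F 1F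
      L-T1² y≈ = trans y≈ (trans (+-congˡ (trans (*-congʳ T13≈0) (zeroˡ _))) (+-identityʳ _))

      orthogonal-4 : ∀ i → 4F ≢ i → T 4F 0F *ᴷ T i 0F +ᴷ T 4F 0F *ᴷ T i 2F ≈ 0#
      orthogonal-4 i 4≢i = trans (+-congˡ (*-congʳ (twin-columns 4F (λ ()) (λ ())))) (twin-orthogonal 4F i 4≢i)

    T1+T3-vanishes : ∀ r → T 1F r +ᴷ T 3F r ≈ 0#
    T1+T3-vanishes 0F = T1+T3≈0 0F (λ ()) (λ ())
    T1+T3-vanishes 1F = trans T1+T3-at-1 (trans (+-cong N≈0 N≈0) (+-identityˡ 0#))
    T1+T3-vanishes 2F = T1+T3≈0 2F (λ ()) (λ ())
    T1+T3-vanishes 3F = trans T1+T3-at-3 (trans (+-cong N≈0 N≈0) (+-identityˡ 0#))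
    T1+T3-vanishes (suc (suc (suc (suc r)))) = T1+T3≈0 (pathVertex r) (λ ()) (λ ())

    T1-vanishes : ∀ r → T 1F r ≈ 0#
    T1-vanishes r = x+y≈0∧xy≈0⇒x≈0 (T1+T3-vanishes r) (T1*T3≈0 r)

    T3-vanishes : ∀ r → T 3F r ≈ 0#
    T3-vanishes r = x+y≈0∧xy≈0⇒y≈0 (T1+T3-vanishes r) (T1*T3≈0 r)

    -- The nonzero vector `e 1F` has the same image as 0.
    not-injective : ¬ (∀ {x y} → (∀ k → f x k ≈ f y k) → ∀ k → x k ≈ y k)
    not-injective injective = ≈⇒¬# (injective {e 1F} {λ _ → 0#}
      (λ r → trans (T1-vanishes r) (sym (IsAlgebraHomomorphism.0ᴹ-homo hom r))) 1F) 1#0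

    -- Vanishing of all images when -1 has no square root.

    module _ (noSqrt : NoSqrtOfMinusOne) where

      T0-vanishes : ∀ r → T 0F r ≈ 0#
      T0-vanishes 0F = NoSqrtOfMinusOne⇒anisotropic noSqrt N≈0
      T0-vanishes 1F = T0≈0 1F (λ ()) (λ ())
      T0-vanishes 2F = NoSqrtOfMinusOne⇒anisotropic noSqrt (trans (+-comm _ _) N≈0)
      T0-vanishes (suc (suc (suc r))) = T0≈0 (suc (suc (suc r))) (λ ()) (λ ())

      T2-vanishes : ∀ r → T 2F r ≈ 0#
      T2-vanishes = go
        where
        -- The norm of `T 2F` on the twins equals `N`, by row 1 of the equality of squares.
        N₂≈0 : T 2F 0F *ᴷ T 2F 0F +ᴷ T 2F 2F *ᴷ T 2F 2F ≈ 0#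
        N₂≈0 = trans (sym (L-1 (T 2F ⊙ T 2F))) (trans (sym (L-square-0≈L-square-2 1F))
          (trans (L-1 (T 0F ⊙ T 0F)) N≈0))

        go : ∀ r → T 2F r ≈ 0#
        go 0F = NoSqrtOfMinusOne⇒anisotropic noSqrt N₂≈0
        go 1F = T2≈0 1F (λ ()) (λ ())
        go 2F = NoSqrtOfMinusOne⇒anisotropic noSqrt (trans (+-comm _ _) N₂≈0)
        go (suc (suc (suc r))) = T2≈0 (suc (suc (suc r))) (λ ()) (λ ())

      -- If `e i` is killed, so is its square, hence the images of the neighbours of `i` sum to 0.
      square-vanishes : ∀ i → (∀ r → T i r ≈ 0#) → ∀ r → L (λ k → T k r) i ≈ 0#
      square-vanishes i Ti≈0 r = trans (L-square i r) (trans
        (*-congˡ (L-zero (T i ⊙ T i) (λ k → trans (*-congʳ (Ti≈0 k)) (zeroˡ _)) r)) (zeroʳ _))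

      T4-vanishes : ∀ r → T 4F r ≈ 0#
      T4-vanishes r = begin
        T 4F r                         ≈⟨ +-identityˡ _ ⟨
        0# +ᴷ T 4F r                   ≈⟨ +-congʳ (+-identityˡ 0#) ⟨
        0# +ᴷ 0# +ᴷ T 4F r             ≈⟨ +-congʳ (+-cong (T0-vanishes r) (T2-vanishes r)) ⟨
        T 0F r +ᴷ T 2F r +ᴷ T 4F r     ≈⟨ L-3 (λ k → T k r) ⟨
        L (λ k → T k r) 3F             ≈⟨ square-vanishes 3F T3-vanishes r ⟩
        0#                             ∎

      T-vanishes : ∀ i r → T i r ≈ 0#
      T-vanishes 0F = T0-vanishes
      T-vanishes 1F = T1-vanishes
      T-vanishes 2F = T2-vanishes
      T-vanishes (suc (suc (suc i))) =
        -- The recurrence starts from vertices 3 and 4, and its row `j` is the neighbour sum at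
        -- `pathVertex j`.
        path-vanishes l (λ i → T (suc (suc (suc i)))) T3-vanishes T4-vanishes
          (λ j Tj≈0 r → trans (sym (L-path (λ k → T k r) j)) (square-vanishes (pathVertex j) Tj≈0 r)) i

      null : ∀ x r → f x r ≈ 0#
      null x r = trans (f-expand x r)
        (sum-zero (λ k → x k *ᴷ T k r) (λ k → trans (*-congˡ (T-vanishes k r)) (zeroʳ _)))

-- The null map as a homomorphism, and the conclusion.

module _ {r ℓr a ℓa b ℓb} {R : Ring r ℓr} (A : Algebra R a ℓa) (B : Algebra R b ℓb) where
  private
    module A = Algebra A
    module B = Algebra B

  null⇒homomorphism : ∀ {f} → IsNull A B f → IsAlgebraHomomorphism A B f
  null⇒homomorphism f≈0 = record
    { isLeftModuleHomomorphism = record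
      { +ᴹ-isGroupHomomorphism = record
        { isMonoidHomomorphism = record
          { isMagmaHomomorphism = record
            { isRelHomomorphism = record { cong = λ {x} {y} _ → B.≈ᴹ-trans (f≈0 x) (B.≈ᴹ-sym (f≈0 y)) }
            ; homo = λ x y → null (x A.+ᴹ y) (B.≈ᴹ-trans (B.+ᴹ-cong (f≈0 x) (f≈0 y)) (B.+ᴹ-identityˡ B.0ᴹ))
            }
          ; ε-homo = f≈0 A.0ᴹ
          }
        ; ⁻¹-homo = λ x → null (A.-ᴹ x) (B.≈ᴹ-trans (B.-ᴹ‿cong (f≈0 x)) -0≈0)
        }
      ; *ₗ-homo = λ s x → null (s A.*ₗ x) (B.≈ᴹ-trans (B.*ₗ-cong (Ring.refl R) (f≈0 x)) (B.*ₗ-zeroʳ s))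
      }
    ; ∙-homo = λ x y → null (x A.∙ y) (B.≈ᴹ-trans (B.∙-cong (f≈0 x) (f≈0 y)) 0∙0≈0)
    }
    where
    null : ∀ x {y} → y B.≈ᴹ B.0ᴹ → _ B.≈ᴹ y
    null x y≈0 = B.≈ᴹ-trans (f≈0 x) (B.≈ᴹ-sym y≈0)

    -0≈0 : B.-ᴹ B.0ᴹ B.≈ᴹ B.0ᴹ
    -0≈0 = B.≈ᴹ-trans (B.≈ᴹ-sym (B.+ᴹ-identityˡ _)) (B.-ᴹ‿inverseʳ B.0ᴹ)

    -- The left factor is rewritten as the scalar 0 times itself, and that scalar is pulled out of
    -- the product.
    0∙0≈0 : B.0ᴹ B.∙ B.0ᴹ B.≈ᴹ B.0ᴹ
    0∙0≈0 = B.≈ᴹ-trans (B.∙-cong (B.≈ᴹ-sym (B.*ₗ-zeroˡ B.0ᴹ)) B.≈ᴹ-refl)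
      (B.≈ᴹ-trans (B.scaleˡ (Ring.0# R) B.0ᴹ B.0ᴹ) (B.*ₗ-zeroˡ _))

proposition3p3 : ∀ {c ℓ₁ ℓ₂} (𝕂 : HeytingField c ℓ₁ ℓ₂) →
    let open EvolutionAlgebras 𝕂 in
    (m : ℕ) → 1 ≤ m → Odd m →
    (deg#0 : DegreesNonzero (T₄ m)) →
    (NoSqrtOfMinusOne →
    ∀ f → IsAlgebraHomomorphism (𝒜RW (T₄ m) deg#0) (𝒜 (T₄ m)) f
    ⇔ IsNull (𝒜RW (T₄ m) deg#0) (𝒜 (T₄ m)) f)
    × ¬ (𝒜RW (T₄ m) deg#0 ≅ 𝒜 (T₄ m))
proposition3p3 𝕂 (suc l) _ odd deg#0 =
    (λ noSqrt f → mk⇔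
      (λ hom → TadpoleHomomorphism.null 𝕂 l odd deg#0 hom noSqrt)
      (null⇒homomorphism (𝒜RW (T₄ (suc l)) deg#0) (𝒜 (T₄ (suc l)))))
  , λ (f , hom , injective , _) → TadpoleHomomorphism.not-injective 𝕂 l odd deg#0 hom injective
  where open EvolutionAlgebras 𝕂
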